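{- Let $p\ge 3$ be an odd natural number, let $K$ be a field of characteristic $0$ with algebraic closure $\overline K$, and let $d,R\in K\smallsetminus\{0\}$ be such that $\sqrt R\notin K$ and the polynomial $g=(Z^p-d)^2-R$ is irreducible in $K[Z]$. Let $y\in\overline K$ be a zero of $h=Z^p-d-\sqrt R$ and $y'\in\overline K$ a zero of $h'=Z^p-d+\sqrt R$. Put $D=d^2-R$, $z=yy'$ and $u=z^{(p-1)/2}(y+y')$. In particular, in this setting $\sqrt R\notin K$, $y,y'$ are irrationals of degree $2p$, and $u$ is a zero of the polynomial $f\in K[Z]$ defined in the context. Then $$\{y,y'\}=\left\{z^{(p+1)/2}\left(\frac{u}{2D}\pm A(u)\sqrt R\right)\right\},$$ where $A\in K[Z]$ is the polynomial defined in the context, and the right-hand side is the set of the two elements obtained from the two choices of sign.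
   Context: An irrational is an element of $\overline K\smallsetminus K$; its degree is the degree of its minimal polynomial over $K$. $\sqrt R\in\overline K$ denotes a fixed choice of one of the two square roots of $R$. Under the assumptions, $D=d^2-R\neq 0$, and $z^p=D$. The polynomial $f\in K[Z]$ (of degree $p$ with leading coefficient $1$) is $$f=D^{(p-1)/2}\sum_{k=0}^{(p-1)/2}\frac{c_{2k+1}}{D^k}Z^{2k+1}-2dD^{(p-1)/2},\qquad c_{2k+1}=(-1)^{(p-1)/2-k}\,\frac{p}{\frac{p+1}{2}+k}\binom{\frac{p+1}{2}+k}{2k+1},$$ for $k=0,\ldots,(p-1)/2$. The polynomial $A\in K[Z]$ is $$A=\frac1{2R}\sum_{k=0}^{(p-1)/2}\frac{a_{2k}}{D^k}Z^{2k}+(-1)^{(p+1)/2}\frac{d}{2RD}Z,\qquad a_{2k}=(-1)^k\,\frac{p-1}{\frac{p-1}{2}+k}\binom{\frac{p-1}{2}+k}{2k},$$ for $k=0,\ldots,(p-1)/2$. Here $\binom{m}{n}$ is the usual binomial coefficient. That $u$ is a zero of $f$ is a fact about the setting that is recalled in the statement, not part of its conclusion. -}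

module Defs where

open import Level using (_⊔_) renaming (suc to lsuc)
open import Algebra.Bundles using (CommutativeRing; RawRing)
open import Algebra.Morphism.Structures using (module RingMorphisms)
import Algebra.Definitions
import Algebra.Definitions.RawSemiring
import Algebra.Properties.Group
open import Data.Fin.Base using (toℕ)
open import Data.List.Base using (List; []; _∷_; map; foldr)
open import Data.Nat.Base as ℕ using (ℕ; zero; suc; NonZero)
open import Data.Nat.Combinatorics using () renaming (_C_ to binomial)
import Data.Nat.DivMod as ℕ
import Data.Nat.Properties as ℕ
open import Data.Product.Base using (∃-syntax; _×_; _,_; proj₁)
open import Data.Sum.Base using (_⊎_)
open import Relation.Binary.PropositionalEquality.Core using (_≡_)
import Relation.Binary.Reasoning.Setoid
open import Relation.Nullary.Negation using (¬_)
open import Relation.Unary using (Pred)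

-- The library's `HeytingField` measures "nonzero" by a separate apartness
-- relation; here it is the classical `≉ 0#`.
record Field c ℓ : Set (lsuc (c ⊔ ℓ)) where
  field
    commutativeRing : CommutativeRing c ℓ

  open CommutativeRing commutativeRing public
  open Algebra.Definitions _≈_ using (Invertible)

  field
    1≉0           : 1# ≉ 0#
    ≉0⇒invertible : ∀ x → x ≉ 0# → Invertible 1# _*_ x

  open CommutativeRing commutativeRing using () renaming (rawRing to raw)
  open Algebra.Definitions.RawSemiring (RawRing.rawSemiring raw) public
    using (_^_) renaming (_×_ to _·_)

  infixl 7 _/_[_]

  _/_[_] : Carrier → ∀ y → y ≉ 0# → Carrier
  x / y [ y≉0 ] = x * proj₁ (≉0⇒invertible y y≉0)

  fromℕ : ℕ → Carrier
  fromℕ n = n · 1#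

  *-cancelˡ-≉0 : ∀ x {y z} → x ≉ 0# → x * y ≈ x * z → y ≈ z
  *-cancelˡ-≉0 x {y} {z} x≉0 xy≈xz with ≉0⇒invertible x x≉0
  ... | w , wx≈1 , _ = begin
    y            ≈⟨ *-identityˡ y ⟨
    1# * y       ≈⟨ *-congʳ wx≈1 ⟨
    (w * x) * y  ≈⟨ *-assoc w x y ⟩
    w * (x * y)  ≈⟨ *-congˡ xy≈xz ⟩
    w * (x * z)  ≈⟨ *-assoc w x z ⟨
    (w * x) * z  ≈⟨ *-congʳ wx≈1 ⟩
    1# * z       ≈⟨ *-identityˡ z ⟩
    z            ∎
    where open Relation.Binary.Reasoning.Setoid setoid

  *-≉0 : ∀ {x y} → x ≉ 0# → y ≉ 0# → x * y ≉ 0#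
  *-≉0 {x} x≉0 y≉0 xy≈0 =
    y≉0 (*-cancelˡ-≉0 x x≉0 (trans xy≈0 (sym (zeroʳ x))))

  ^-≉0 : ∀ {x} → x ≉ 0# → ∀ n → x ^ n ≉ 0#
  ^-≉0 x≉0 zero    = 1≉0
  ^-≉0 x≉0 (suc n) = *-≉0 x≉0 (^-≉0 x≉0 n)

  pair : Carrier → Carrier → Pred Carrier ℓ
  pair a b x = x ≈ a ⊎ x ≈ b

CharacteristicZero : ∀ {c ℓ} → Field c ℓ → Set ℓ
CharacteristicZero K = ∀ n → fromℕ n ≈ 0# → n ≡ 0
  where open Field K

-- A list holds the coefficients, constant term first.  Trailing zeros
-- are allowed, so equality compares the coefficients at every index.
module Polynomial {c ℓ} (K : Field c ℓ) where
  private module K = Field K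
  open K using (Carrier)

  Poly : Set c
  Poly = List Carrier

  coeff : Poly → ℕ → Carrier
  coeff []      _       = K.0#
  coeff (a ∷ _) zero    = a
  coeff (_ ∷ f) (suc n) = coeff f n

  private
    add : Poly → Poly → Poly
    add []      g       = g
    add (a ∷ f) []      = a ∷ f
    add (a ∷ f) (b ∷ g) = a K.+ b ∷ add f g

    mul : Poly → Poly → Poly
    mul []      g = []
    mul (a ∷ f) g = add (map (a K.*_) g) (K.0# ∷ mul f g)

  polyRawRing : RawRing c ℓ
  polyRawRing = record
    { Carrier = Poly
    ; _≈_     = λ f g → ∀ n → coeff f n K.≈ coeff g n
    ; _+_     = add
    ; _*_     = mul
    ; -_      = map (λ a → K.- a)
    ; 0#      = []
    ; 1#      = K.1# ∷ []
    }

  open RawRing polyRawRing public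
    using (_≈_; _≉_; _+_; _*_; -_; 0#; 1#; rawSemiring)
  open Algebra.Definitions.RawSemiring rawSemiring public
    using (_^_; sum; Irreducible)

  infixl 6 _-_

  _-_ : Poly → Poly → Poly
  f - g = f + (- g)

  const : Carrier → Poly
  const a = a ∷ []

  Z : Poly
  Z = K.0# ∷ K.1# ∷ []

  eval : Poly → Carrier → Carrier
  eval f x = foldr (λ a r → a K.+ x K.* r) K.0# f

  IsZeroOf : Carrier → Poly → Set ℓ
  IsZeroOf x f = eval f x K.≈ K.0#

  HasDegree : Poly → ℕ → Set ℓ
  HasDegree f n = coeff f n K.≉ K.0# × (∀ m → n ℕ.< m → coeff f m K.≈ K.0#)

record AlgebraicClosure {c ℓ} (K : Field c ℓ) c′ ℓ′
       : Set (c ⊔ ℓ ⊔ lsuc (c′ ⊔ ℓ′)) where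
  private
    module K    = Field K
    module K[Z] = Polynomial K

  field
    closure : Field c′ ℓ′

  private
    module L    = Field closure
    module L[Z] = Polynomial closure

  open RingMorphisms K.rawRing L.rawRing using (IsRingHomomorphism)

  field
    ι                   : K.Carrier → L.Carrier
    isRingHomomorphism  : IsRingHomomorphism ι
    algebraic           : ∀ x → ∃[ f ] f K[Z].≉ K[Z].0# × L[Z].IsZeroOf x (map ι f)
    algebraicallyClosed : ∀ f n → L[Z].HasDegree f (suc n) → ∃[ x ] L[Z].IsZeroOf x f

  evalAt : K[Z].Poly → L.Carrier → L.Carrier
  evalAt f = L[Z].eval (map ι f)

  open IsRingHomomorphism isRingHomomorphism public
    using (⟦⟧-cong; +-homo; *-homo; -‿homo; 0#-homo; 1#-homo)

module _ {c ℓ} (K : Field c ℓ) where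
  open Field K

  disc : Carrier → Carrier → Carrier
  disc d R = d ^ 2 - R

module _ {c ℓ c′ ℓ′} {K : Field c ℓ} (K̄ : AlgebraicClosure K c′ ℓ′) where
  open AlgebraicClosure K̄
  private
    module K = Field K
    module L = Field closure

  disc≉0 : ∀ d R {√R} → √R L.* √R L.≈ ι R → ¬ (∃[ k ] ι k L.≈ √R) →
           disc K d R K.≉ K.0#
  disc≉0 d R {√R} √R²≈R √R∉K D≈0 = √R∉K (d , ιd≈√R)
    where
    open Relation.Binary.Reasoning.Setoid L.setoid
    module G = Algebra.Properties.Group L.+-group
    module H = Algebra.Properties.Group K.+-group

    dd≈R : d K.* d K.≈ R
    dd≈R = K.trans (K.*-congˡ (K.sym (K.*-identityʳ d))) (H.x∙y⁻¹≈ε⇒x≈y _ _ D≈0)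

    sum≉0 : √R L.+ ι d L.≉ L.0#
    sum≉0 eq = √R∉K (K.- d ,
      L.trans (-‿homo d) (L.sym (G.inverseˡ-unique _ _ eq)))

    eqn : (√R L.+ ι d) L.* ι d L.≈ (√R L.+ ι d) L.* √R
    eqn = begin
      (√R L.+ ι d) L.* ι d          ≈⟨ L.distribʳ _ _ _ ⟩
      √R L.* ι d L.+ ι d L.* ι d    ≈⟨ L.+-cong (L.*-comm _ _) (L.sym (*-homo d d)) ⟩
      ι d L.* √R L.+ ι (d K.* d)    ≈⟨ L.+-congˡ (L.trans (⟦⟧-cong dd≈R) (L.sym √R²≈R)) ⟩
      ι d L.* √R L.+ √R L.* √R      ≈⟨ L.+-comm _ _ ⟩
      √R L.* √R L.+ ι d L.* √R      ≈⟨ L.distribʳ _ _ _ ⟨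
      (√R L.+ ι d) L.* √R           ∎

    ιd≈√R : ι d L.≈ √R
    ιd≈√R = L.*-cancelˡ-≉0 _ sum≉0 eqn

module _ {c ℓ} (K : Field c ℓ) (p : ℕ) (d : Field.Carrier K) where
  open Polynomial K

  gPoly : Field.Carrier K → Poly
  gPoly R = (Z ^ p - const d) ^ 2 - const R

  hPoly : Field.Carrier K → Poly
  hPoly √R = Z ^ p - const d - const √R

  h′Poly : Field.Carrier K → Poly
  h′Poly √R = Z ^ p - const d + const √R

module _ {c ℓ} (K : Field c ℓ) (char0 : CharacteristicZero K) where
  open Field K
  private module K[Z] = Polynomial K

  fromℕ≉0 : ∀ n → .{{NonZero n}} → fromℕ n ≉ 0#
  fromℕ≉0 n n≈0 = ℕ.≢-nonZero⁻¹ n (char0 n n≈0)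

  half[p-1]+k-nonZero : ∀ {p} → 3 ℕ.≤ p → ∀ k → NonZero ((p ℕ.∸ 1) ℕ./ 2 ℕ.+ k)
  half[p-1]+k-nonZero {p} 3≤p k = ℕ.>-nonZero
    (ℕ.≤-trans (ℕ./-monoˡ-≤ 2 (ℕ.∸-monoˡ-≤ 1 3≤p)) (ℕ.m≤m+n _ k))

  module _ (p : ℕ) (3≤p : 3 ℕ.≤ p) where

    a₂ₖ : ℕ → Carrier
    a₂ₖ k = (- 1#) ^ k
          * (fromℕ (p ℕ.∸ 1) / fromℕ (m ℕ.+ k) [ fromℕ≉0 (m ℕ.+ k) {{half[p-1]+k-nonZero 3≤p k}} ])
          * fromℕ (binomial (m ℕ.+ k) (2 ℕ.* k))
      where m = (p ℕ.∸ 1) ℕ./ 2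

    module _ (d R : Carrier) (R≉0 : R ≉ 0#) (D≉0 : disc K d R ≉ 0#) where
      private
        D = disc K d R

        2R≉0 : fromℕ 2 * R ≉ 0#
        2R≉0 = *-≉0 (fromℕ≉0 2) R≉0

      APoly : K[Z].Poly
      APoly =
        K[Z].const (1# / (fromℕ 2 * R) [ 2R≉0 ])
          K[Z].* K[Z].sum {suc ((p ℕ.∸ 1) ℕ./ 2)} (λ i → let k = toℕ i in
            K[Z].const (a₂ₖ k / D ^ k [ ^-≉0 D≉0 k ]) K[Z].* K[Z].Z K[Z].^ (2 ℕ.* k))
        K[Z].+
        K[Z].const ((- 1#) ^ ((p ℕ.+ 1) ℕ./ 2) * (d / (fromℕ 2 * R * D) [ *-≉0 2R≉0 D≉0 ]))
          K[Z].* K[Z].Z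

-- Write p = 2M + 1 and t = u²/D, so that z t = (y + y′)². Up to sign, a₂ₖ is the
-- coefficient expressing the power sum of index 2M through y + y′ and z, so the
-- sum in A equals z⁻ᴹ ((-y²)ᴹ + (-y′²)ᴹ). With y^p = d + √R, y′^p = d - √R and
-- z^p = D this gives
--   2 z^(M+1) A(u) √R = (-1)ᴹ (y′ - y)   and   2 z^(M+1) u/2D = y + y′,
-- so y, y′ are half the sum and half the difference of these two, up to order.

module Submission where

open import Defs
open import Algebra.Bundles using (CommutativeRing)
open import Algebra.Morphism.Structures using (module RingMorphisms)
import Algebra.Morphism.Construct.Identity as Identity
import Algebra.Properties.CommutativeMonoid.Sum
import Algebra.Properties.CommutativeSemiring.Exp
import Algebra.Properties.Group
import Algebra.Properties.Ring
import Algebra.Properties.Semiring.Mult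
import Algebra.Properties.Semiring.Sum
import Algebra.Solver.Ring.NaturalCoefficients.Default
open import Data.Empty using (⊥-elim)
open import Data.Fin.Base using (Fin; zero; suc; toℕ)
open import Data.List.Base using ([]; _∷_; map)
open import Data.List.Properties using (map-id)
open import Data.Nat.Base as ℕ using (ℕ; zero; suc; s≤s; z≤n)
open import Data.Nat.Combinatorics
  using (_C_; nC1≡n; nCn≡1; nCk≡nC[n∸k]; nCk+nC[k+1]≡[n+1]C[k+1]; k>n⇒nCk≡0)
open import Data.Nat.Divisibility using (_∣_; m%n≡0⇒n∣m)
import Data.Nat.DivMod as ℕ
import Data.Nat.Properties as ℕ
open import Data.Nat.Solver using (module +-*-Solver)
open import Data.Product.Base using (∃-syntax; _×_; _,_; proj₁; proj₂)
open import Data.Sum.Base using (_⊎_; inj₁; inj₂)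
open import Relation.Binary.PropositionalEquality as ≡ using (_≡_)
import Relation.Binary.Reasoning.Setoid
open import Relation.Nullary.Negation using (¬_)
open import Relation.Unary using (_≐_)

-- With x = -t the signs of the a₂ₖ disappear, and the sum in A becomes a polynomial in x with
-- natural coefficients: the sum of two consecutive Morgan-Voyce polynomials. These sums, λ n,
-- satisfy λ (n+2) + λ n = (2 + x) λ (n+1). Since z (2 - t) = 2z - (y + y′)² = (-y²) + (-y′²) and z²
-- = (-y²)(-y′²), the products z^n λ n obey the recurrence of the power sums of -y² and -y′². No
-- square root of t is ever needed. One further factor z turns (-y²)ᴹ into (-1)ᴹ y′ y^p, so the sum
-- contributes (-1)ᴹ (d (y + y′) + √R (y′ - y)). The linear term of A is what removes d (y + y′).
-- The central algebra takes place in an arbitrary commutative ring, where each quotient is a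
-- variable bound by an equation without division. Identities are normalised over semirings, so
-- differences are moved across the equation, or written with a factor `- 1#` that the normaliser
-- sees as an indeterminate.

-- Binomial identities and the integrality of the coefficients.

nC0≡1 : ∀ n → n C 0 ≡ 1
nC0≡1 n = ≡.trans (nCk≡nC[n∸k] {0} {n} z≤n) (nCn≡1 n)

-- Absorption identity. In the main case one copy of `c` is kept aside and Pascal's rule splits the
-- other n + 1; the induction hypotheses turn these into (k+1) c + (k+2) c′, and the spare copy
-- evens out the factors.
[n+1]*nCk≡[k+1]*[n+1]C[k+1] : ∀ n k → suc n ℕ.* (n C k) ≡ suc k ℕ.* (suc n C suc k)
[n+1]*nCk≡[k+1]*[n+1]C[k+1] zero zero = ≡.refl
[n+1]*nCk≡[k+1]*[n+1]C[k+1] zero (suc k) = ≡.sym (≡.trans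
  (≡.cong (suc (suc k) ℕ.*_) (k>n⇒nCk≡0 (s≤s (s≤s (z≤n {k})))))
  (ℕ.*-zeroʳ k))
[n+1]*nCk≡[k+1]*[n+1]C[k+1] (suc n) zero = begin
  suc (suc n) ℕ.* (suc n C 0)  ≡⟨ ≡.cong (suc (suc n) ℕ.*_) (nC0≡1 (suc n)) ⟩
  suc (suc n) ℕ.* 1            ≡⟨ ℕ.*-identityʳ _ ⟩
  suc (suc n)                  ≡⟨ nC1≡n (suc (suc n)) ⟨
  suc (suc n) C 1              ≡⟨ ℕ.*-identityˡ _ ⟨
  1 ℕ.* (suc (suc n) C 1)      ∎
  where open ≡.≡-Reasoning
[n+1]*nCk≡[k+1]*[n+1]C[k+1] (suc n) (suc k) = begin
  suc (suc n) ℕ.* c                              ≡⟨⟩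
  c ℕ.+ suc n ℕ.* c                              ≡⟨ ≡.cong (λ v → c ℕ.+ suc n ℕ.* v) (nCk+nC[k+1]≡[n+1]C[k+1] n k) ⟨
  c ℕ.+ suc n ℕ.* ((n C k) ℕ.+ (n C suc k))      ≡⟨ ≡.cong (c ℕ.+_) (ℕ.*-distribˡ-+ (suc n) (n C k) (n C suc k)) ⟩
  c ℕ.+ (suc n ℕ.* (n C k) ℕ.+ suc n ℕ.* (n C suc k))
    ≡⟨ ≡.cong (c ℕ.+_) (≡.cong₂ ℕ._+_ ([n+1]*nCk≡[k+1]*[n+1]C[k+1] n k) ([n+1]*nCk≡[k+1]*[n+1]C[k+1] n (suc k))) ⟩
  c ℕ.+ (suc k ℕ.* c ℕ.+ suc (suc k) ℕ.* c′)     ≡⟨ ℕ.+-assoc c _ _ ⟨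
  suc (suc k) ℕ.* c ℕ.+ suc (suc k) ℕ.* c′       ≡⟨ ℕ.*-distribˡ-+ (suc (suc k)) c c′ ⟨
  suc (suc k) ℕ.* (c ℕ.+ c′)                     ≡⟨ ≡.cong (suc (suc k) ℕ.*_) (nCk+nC[k+1]≡[n+1]C[k+1] (suc n) (suc k)) ⟩
  suc (suc k) ℕ.* (suc (suc n) C suc (suc k))    ∎
  where
  open ≡.≡-Reasoning
  c  = suc n C suc k
  c′ = suc n C suc (suc k)

-- The companion absorption (n+1) C(n,k) = (n+1-k) C(n+1,k), with the subtracted part moved to the
-- left.
[n+1]*nCk+k*[n+1]Ck≡[n+1]*[n+1]Ck : ∀ n k →
  suc n ℕ.* (n C k) ℕ.+ k ℕ.* (suc n C k) ≡ suc n ℕ.* (suc n C k)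
[n+1]*nCk+k*[n+1]Ck≡[n+1]*[n+1]Ck n zero = ≡.trans (ℕ.+-identityʳ _)
  (≡.cong (suc n ℕ.*_) (≡.trans (nC0≡1 n) (≡.sym (nC0≡1 (suc n)))))
[n+1]*nCk+k*[n+1]Ck≡[n+1]*[n+1]Ck n (suc k) = begin
  suc n ℕ.* (n C suc k) ℕ.+ suc k ℕ.* (suc n C suc k)
    ≡⟨ ≡.cong (suc n ℕ.* (n C suc k) ℕ.+_) ([n+1]*nCk≡[k+1]*[n+1]C[k+1] n k) ⟨
  suc n ℕ.* (n C suc k) ℕ.+ suc n ℕ.* (n C k)  ≡⟨ ℕ.*-distribˡ-+ (suc n) (n C suc k) (n C k) ⟨
  suc n ℕ.* ((n C suc k) ℕ.+ (n C k))          ≡⟨ ≡.cong (suc n ℕ.*_) (ℕ.+-comm (n C suc k) _) ⟩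
  suc n ℕ.* ((n C k) ℕ.+ (n C suc k))          ≡⟨ ≡.cong (suc n ℕ.*_) (nCk+nC[k+1]≡[n+1]C[k+1] n k) ⟩
  suc n ℕ.* (suc n C suc k)                    ∎
  where open ≡.≡-Reasoning

-- The absolute value of the coefficient of t^k in 2 T₂ₘ₊₂(√t / 2), where T is
-- the Chebyshev polynomial.
lucas : ℕ → ℕ → ℕ
lucas m k = ((suc m ℕ.+ k) C (2 ℕ.* k)) ℕ.+ ((m ℕ.+ k) C (2 ℕ.* k))

-- With M = m + 1, absorption gives (M+k) C(M+k-1,2k) = (M-k) C(M+k,2k), and (M+k) + (M-k) = 2M.
-- Hence the quotient 2M/(M+k) in a₂ₖ leaves an integer. Adding 2k C(M+k,2k) to both sides avoids
-- the difference M - k.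
lucas-ratio : ∀ m k →
  (suc m ℕ.+ k) ℕ.* lucas m k ≡ (2 ℕ.* suc m) ℕ.* ((suc m ℕ.+ k) C (2 ℕ.* k))
lucas-ratio m k = ℕ.+-cancelʳ-≡ (2 ℕ.* k ℕ.* c) _ _ (begin
  n ℕ.* (c ℕ.+ c′) ℕ.+ 2 ℕ.* k ℕ.* c
    ≡⟨ solve 4 (λ n k c c′ → n :* (c :+ c′) :+ con 2 :* k :* c := n :* c :+ (n :* c′ :+ con 2 :* k :* c))
         ≡.refl n k c c′ ⟩
  n ℕ.* c ℕ.+ (n ℕ.* c′ ℕ.+ 2 ℕ.* k ℕ.* c)
    ≡⟨ ≡.cong (n ℕ.* c ℕ.+_) ([n+1]*nCk+k*[n+1]Ck≡[n+1]*[n+1]Ck (m ℕ.+ k) (2 ℕ.* k)) ⟩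
  n ℕ.* c ℕ.+ n ℕ.* c
    ≡⟨ solve 3 (λ m k c → (con 1 :+ m :+ k) :* c :+ (con 1 :+ m :+ k) :* c :=
                          con 2 :* (con 1 :+ m) :* c :+ con 2 :* k :* c)
         ≡.refl m k c ⟩
  2 ℕ.* suc m ℕ.* c ℕ.+ 2 ℕ.* k ℕ.* c  ∎)
  where
  open ≡.≡-Reasoning
  open +-*-Solver
  n  = suc m ℕ.+ k
  c  = n C (2 ℕ.* k)
  c′ = (m ℕ.+ k) C (2 ℕ.* k)

-- Morgan-Voyce polynomials and power sums.

module MorganVoyce {c ℓ} (R : CommutativeRing c ℓ) (x : CommutativeRing.Carrier R) where
  open CommutativeRing R
  open Algebra.Properties.Semiring.Mult semiring
    using (×-homo-+; ×-congˡ; ×-congʳ; ×-homo-1; ×-comm-*) renaming (_×_ to _·_)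
  open Algebra.Properties.Semiring.Sum semiring using (sum; sum-cong-≋; sum-replicate-zero; *-distribˡ-sum)
  open Algebra.Properties.CommutativeMonoid.Sum +-commutativeMonoid using (∑-distrib-+)
  open Algebra.Properties.CommutativeSemiring.Exp commutativeSemiring using (_^_)
  open Algebra.Solver.Ring.NaturalCoefficients.Default commutativeSemiring
  open Relation.Binary.Reasoning.Setoid setoid

  -- The Morgan-Voyce polynomials; β m + β (m - 1) is a rescaled Chebyshev polynomial.
  β ε : ℕ → Carrier
  β zero    = 1#
  β (suc m) = β m + x * ε m
  ε zero    = 1#
  ε (suc m) = ε m + β (suc m)

  private
    bTerm eTerm : ℕ → ℕ → Carrier
    bTerm m k = ((m ℕ.+ k) C (2 ℕ.* k)) · x ^ k
    eTerm m k = (suc (m ℕ.+ k) C suc (2 ℕ.* k)) · x ^ k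

    pascal : ∀ n k y → (suc n C suc k) · y ≈ (n C k) · y + (n C suc k) · y
    pascal n k y = trans (×-congˡ (≡.sym (nCk+nC[k+1]≡[n+1]C[k+1] n k))) (×-homo-+ y (n C k) (n C suc k))

    bTerm-zero : ∀ m → bTerm m 0 ≈ 1#
    bTerm-zero m = trans (×-congˡ (nC0≡1 (m ℕ.+ 0))) (×-homo-1 1#)

    bTerm-suc : ∀ m k → bTerm (suc m) (suc k) ≈ bTerm m (suc k) + x * eTerm m k
    bTerm-suc m k
      -- Both rewrites pull successors outward, so that the indices read m+k+2 over 2k+2 and
      -- Pascal's rule applies.
      rewrite ℕ.+-suc m k | ℕ.+-suc k (k ℕ.+ 0) = begin
        (suc (suc (m ℕ.+ k)) C suc (suc (2 ℕ.* k))) · (x * x ^ k)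
          ≈⟨ pascal (suc (m ℕ.+ k)) (suc (2 ℕ.* k)) _ ⟩
        n · (x * x ^ k) + (suc (m ℕ.+ k) C suc (suc (2 ℕ.* k))) · (x * x ^ k)
          ≈⟨ +-comm _ _ ⟩
        (suc (m ℕ.+ k) C suc (suc (2 ℕ.* k))) · (x * x ^ k) + n · (x * x ^ k)
          ≈⟨ +-congˡ (sym (×-comm-* n x (x ^ k))) ⟩
        (suc (m ℕ.+ k) C suc (suc (2 ℕ.* k))) · (x * x ^ k) + x * (n · x ^ k) ∎
      where n = suc (m ℕ.+ k) C suc (2 ℕ.* k)

    eTerm-suc : ∀ m k → eTerm (suc m) k ≈ eTerm m k + bTerm (suc m) k
    eTerm-suc m k = trans (pascal (suc (m ℕ.+ k)) (2 ℕ.* k) (x ^ k)) (+-comm _ _)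

  bSum eSum : ℕ → ℕ → Carrier
  bSum N m = sum {N} (λ i → bTerm m (toℕ i))
  eSum N m = sum {N} (λ i → eTerm m (toℕ i))

  private
    n<k⇒nCk·y≈0 : ∀ {n k} → n ℕ.< k → ∀ y → (n C k) · y ≈ 0#
    n<k⇒nCk·y≈0 n<k y = ×-congˡ (k>n⇒nCk≡0 n<k)

    tail-zero : ∀ N (f : Fin N → Carrier) → (∀ i → f i ≈ 0#) → sum f ≈ 0#
    tail-zero N f f≈0 = trans (sum-cong-≋ {N} f≈0) (sum-replicate-zero N)

    bSum-zero : ∀ N → bSum (suc N) 0 ≈ 1#
    bSum-zero N = trans
      (+-cong (bTerm-zero 0) (tail-zero N _ (λ i →
        n<k⇒nCk·y≈0 (s≤s (ℕ.m<m+n (toℕ i) (s≤s z≤n))) _)))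
      (+-identityʳ 1#)

    eSum-zero : ∀ N → eSum (suc N) 0 ≈ 1#
    eSum-zero N = trans
      (+-cong (×-homo-1 1#) (tail-zero N _ (λ i →
        n<k⇒nCk·y≈0 (s≤s (s≤s (ℕ.m<m+n (toℕ i) (s≤s z≤n)))) _)))
      (+-identityʳ 1#)

    bSum-suc : ∀ N m → bSum (suc N) (suc m) ≈ bSum (suc N) m + x * eSum N m
    bSum-suc N m = begin
      bTerm (suc m) 0 + sum {N} (λ i → bTerm (suc m) (suc (toℕ i)))
        ≈⟨ +-cong (trans (bTerm-zero (suc m)) (sym (bTerm-zero m)))
                  (sum-cong-≋ {N} (λ i → bTerm-suc m (toℕ i))) ⟩
      bTerm m 0 + sum {N} (λ i → bTerm m (suc (toℕ i)) + x * eTerm m (toℕ i))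
        ≈⟨ +-congˡ (∑-distrib-+ {N} _ _) ⟩
      bTerm m 0 + (sum {N} (λ i → bTerm m (suc (toℕ i))) + sum {N} (λ i → x * eTerm m (toℕ i)))
        ≈⟨ +-assoc _ _ _ ⟨
      bSum (suc N) m + sum {N} (λ i → x * eTerm m (toℕ i))
        ≈⟨ +-congˡ (*-distribˡ-sum {N} x _) ⟨
      bSum (suc N) m + x * eSum N m ∎

    eSum-suc : ∀ N m → eSum N (suc m) ≈ eSum N m + bSum N (suc m)
    eSum-suc N m = trans (sum-cong-≋ {N} (λ i → eTerm-suc m (toℕ i))) (∑-distrib-+ {N} _ _)

  -- Terms with k > m vanish, because 2k exceeds m+k. The length `N` stays free since multiplication
  -- by x shifts the index, pairing N+1 terms of one sum with N of the other, and since `lucasSum`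
  -- takes `β m` with one term more than its degree.
  bSum≈β×eSum≈ε : ∀ m N → m ℕ.< N → (bSum N m ≈ β m) × (eSum N m ≈ ε m)
  bSum≈β×eSum≈ε zero    (suc N) _         = bSum-zero N , eSum-zero N
  bSum≈β×eSum≈ε (suc m) (suc N) (s≤s m<N) = b , trans (eSum-suc (suc N) m) (+-cong (proj₂ IH) b)
    where
    IH = bSum≈β×eSum≈ε m (suc N) (ℕ.m<n⇒m<1+n m<N)
    b  = trans (bSum-suc N m)
           (+-cong (proj₁ IH) (*-congˡ (proj₂ (bSum≈β×eSum≈ε m N m<N))))

  lucasSum : ℕ → Carrier
  lucasSum m = sum {suc (suc m)} (λ i → lucas m (toℕ i) · x ^ toℕ i)

  lucasSum≈β+β : ∀ m → lucasSum m ≈ β (suc m) + β m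
  lucasSum≈β+β m = begin
    lucasSum m
      ≈⟨ sum-cong-≋ {N} (λ i → ×-homo-+ (x ^ toℕ i) ((suc m ℕ.+ toℕ i) C (2 ℕ.* toℕ i)) ((m ℕ.+ toℕ i) C (2 ℕ.* toℕ i))) ⟩
    sum {N} (λ i → bTerm (suc m) (toℕ i) + bTerm m (toℕ i))
      ≈⟨ ∑-distrib-+ {N} (λ i → bTerm (suc m) (toℕ i)) (λ i → bTerm m (toℕ i)) ⟩
    bSum N (suc m) + bSum N m
      ≈⟨ +-cong (proj₁ (bSum≈β×eSum≈ε (suc m) N ℕ.≤-refl)) (proj₁ (bSum≈β×eSum≈ε m N (ℕ.m≤n+m (suc m) 1))) ⟩
    β (suc m) + β m ∎
    where N = suc (suc m)

  private
    λₙ : ℕ → Carrier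
    -- Running the recurrence backwards gives β(-1) = 1, so this is β(0) + β(-1); it is also P^0 +
    -- Q^0.
    λₙ zero    = 1# + 1#
    λₙ (suc n) = β (suc n) + β n

    λₙ-rec : ∀ n → λₙ (suc (suc n)) + λₙ n ≈ (1# + 1# + x) * λₙ (suc n)
    λₙ-rec zero = solve 1 (λ x →
      let b = con 1 :+ x :* con 1 in
      b :+ x :* (con 1 :+ b) :+ b :+ (con 1 :+ con 1) :=
      (con 1 :+ con 1 :+ x) :* (b :+ con 1)) refl x
    λₙ-rec (suc n) = solve 3 (λ x b₀ e₀ →
      let b₁ = b₀ :+ x :* e₀
          e₁ = e₀ :+ b₁
          b₂ = b₁ :+ x :* e₁
          e₂ = e₁ :+ b₂
          b₃ = b₂ :+ x :* e₂
      in b₃ :+ b₂ :+ (b₁ :+ b₀) := (con 1 :+ con 1 :+ x) :* (b₂ :+ b₁)) refl x (β n) (ε n)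

  module _ {z P Q : Carrier} (trace : z * (1# + 1# + x) ≈ P + Q) (norm : z * z ≈ P * Q) where
    private
      -- Both sides satisfy X(n+2) = (P+Q) X(n+1) - PQ X(n): by `trace` and `norm`, P/z and Q/z play
      -- the part of the roots of T² - (2+x) T + 1.
      z^n*λₙ≈P^n+Q^n : ∀ n → z ^ n * λₙ n ≈ P ^ n + Q ^ n
      z^n*λₙ≈P^n+Q^n zero          = *-identityˡ _
      z^n*λₙ≈P^n+Q^n (suc zero)    = begin
        z * 1# * (1# + x * 1# + 1#)
          ≈⟨ solve 2 (λ z x → z :* con 1 :* (con 1 :+ x :* con 1 :+ con 1) := z :* (con 1 :+ con 1 :+ x)) refl z x ⟩
        z * (1# + 1# + x)    ≈⟨ trace ⟩
        P + Q                ≈⟨ +-cong (*-identityʳ P) (*-identityʳ Q) ⟨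
        P * 1# + Q * 1#      ∎
      -- The subtracted term of the recurrence is added to both sides and cancelled at the end.
      z^n*λₙ≈P^n+Q^n (suc (suc n)) = ∙-cancelʳ (P * Q * (P ^ n + Q ^ n)) _ _ (begin
        z * (z * z ^ n) * λₙ (suc (suc n)) + P * Q * (P ^ n + Q ^ n)
          ≈⟨ +-congˡ (*-cong norm (z^n*λₙ≈P^n+Q^n n)) ⟨
        z * (z * z ^ n) * λₙ (suc (suc n)) + z * z * (z ^ n * λₙ n)
          ≈⟨ solve 4 (λ z t l l′ → z :* (z :* t) :* l :+ z :* z :* (t :* l′) := z :* (z :* t) :* (l :+ l′))
               refl z (z ^ n) (λₙ (suc (suc n))) (λₙ n) ⟩
        z * (z * z ^ n) * (λₙ (suc (suc n)) + λₙ n)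
          ≈⟨ *-congˡ (λₙ-rec n) ⟩
        z * (z * z ^ n) * ((1# + 1# + x) * λₙ (suc n))
          ≈⟨ solve 4 (λ z t a l → z :* (z :* t) :* (a :* l) := z :* a :* (z :* t :* l))
               refl z (z ^ n) (1# + 1# + x) (λₙ (suc n)) ⟩
        z * (1# + 1# + x) * (z ^ suc n * λₙ (suc n))
          ≈⟨ *-cong trace (z^n*λₙ≈P^n+Q^n (suc n)) ⟩
        (P + Q) * (P * P ^ n + Q * Q ^ n)
          ≈⟨ solve 4 (λ P Q a b → (P :+ Q) :* (P :* a :+ Q :* b) :=
                                  P :* (P :* a) :+ Q :* (Q :* b) :+ P :* Q :* (a :+ b))
               refl P Q (P ^ n) (Q ^ n) ⟩
        P * (P * P ^ n) + Q * (Q * Q ^ n) + P * Q * (P ^ n + Q ^ n) ∎)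
        where open Algebra.Properties.Group +-group using (∙-cancelʳ)

    z^[m+1]*lucasSum≈P^[m+1]+Q^[m+1] : ∀ m → z ^ suc m * lucasSum m ≈ P ^ suc m + Q ^ suc m
    z^[m+1]*lucasSum≈P^[m+1]+Q^[m+1] m =
      trans (*-congˡ (lucasSum≈β+β m)) (z^n*λₙ≈P^n+Q^n (suc m))

-- The radical identities in a commutative ring.

module SignProperties {c ℓ} (R : CommutativeRing c ℓ) where
  open CommutativeRing R
  open Algebra.Properties.Group +-group using (⁻¹-involutive)
  open Algebra.Properties.Ring ring using (-1*x≈-x)

  -1*-1≈1 : - 1# * - 1# ≈ 1#
  -1*-1≈1 = trans (-1*x≈-x (- 1#)) (⁻¹-involutive 1#)

  -1*x+x≈0 : ∀ x → - 1# * x + x ≈ 0#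
  -1*x+x≈0 x = trans (+-congʳ (-1*x≈-x x)) (-‿inverseˡ x)

-- Here M is (p-1)/2, a successor because p ≥ 3; `suc (M * 2)` stands for p and `r` for √R.
module Radicals {c ℓ} (R₀ : CommutativeRing c ℓ) (m : ℕ) where
  open CommutativeRing R₀ hiding (zero)
  open Algebra.Properties.CommutativeSemiring.Exp commutativeSemiring
  open Algebra.Solver.Ring.NaturalCoefficients.Default commutativeSemiring
    using (solve; con; _:+_; _:*_; _:=_)
  open Algebra.Properties.Group +-group using () renaming (∙-cancelʳ to +-cancelʳ)
  open SignProperties R₀
  open Relation.Binary.Reasoning.Setoid setoid
  open MorganVoyce R₀ using (lucasSum; z^[m+1]*lucasSum≈P^[m+1]+Q^[m+1])

  private
    M : ℕ
    M = suc m

    x^[2M+1]≈x*x^M*x^M : ∀ x → x ^ suc (M ℕ.* 2) ≈ x * (x ^ M * x ^ M)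
    x^[2M+1]≈x*x^M*x^M x = *-congˡ (begin
      x ^ (M ℕ.* 2)         ≈⟨ ^-assocʳ x M 2 ⟨
      x ^ M * (x ^ M * 1#)  ≈⟨ *-congˡ (*-identityʳ (x ^ M)) ⟩
      x ^ M * x ^ M         ∎)

    cancel : ∀ {a b x y} → b * a ≈ 1# → a * x ≈ a * y → x ≈ y
    cancel {a} {b} {x} {y} ba≈1 ax≈ay = begin
      x            ≈⟨ *-identityˡ x ⟨
      1# * x       ≈⟨ *-congʳ ba≈1 ⟨
      b * a * x    ≈⟨ *-assoc b a x ⟩
      b * (a * x)  ≈⟨ *-congˡ ax≈ay ⟩
      b * (a * y)  ≈⟨ *-assoc b a y ⟨
      b * a * y    ≈⟨ *-congʳ ba≈1 ⟩
      1# * y       ≈⟨ *-identityˡ y ⟩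
      y            ∎

  module _ {y y′ d r D : Carrier}
    (y^p≈d+r : y ^ suc (M ℕ.* 2) ≈ d + r) (y′^p+r≈d : y′ ^ suc (M ℕ.* 2) + r ≈ d)
    (D+r²≈d² : D + r * r ≈ d * d) where
    private
      z = y * y′
      s = y + y′
      u = z ^ M * s
      w = z ^ suc M
      μ = (- 1#) ^ M

    -- Writing d = y′^p + r gives d² = (y′^p + 2r) y′^p + r², and y′^p + 2r = d + r = y^p.
    D≈z^p : D ≈ z * (z ^ M * z ^ M)
    D≈z^p = +-cancelʳ (r * r) _ _ (begin
      D + r * r                    ≈⟨ D+r²≈d² ⟩
      d * d                        ≈⟨ *-cong y′^p+r≈d y′^p+r≈d ⟨
      (b′ + r) * (b′ + r)
        ≈⟨ solve 2 (λ b r → (b :+ r) :* (b :+ r) := (b :+ r :+ r) :* b :+ r :* r) refl b′ r ⟩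
      (b′ + r + r) * b′ + r * r    ≈⟨ +-congʳ (*-congʳ (+-congʳ y′^p+r≈d)) ⟩
      (d + r) * b′ + r * r         ≈⟨ +-congʳ (*-congʳ y^p≈d+r) ⟨
      y ^ suc (M ℕ.* 2) * b′ + r * r ≈⟨ +-congʳ (^-distrib-* y y′ (suc (M ℕ.* 2))) ⟨
      z ^ suc (M ℕ.* 2) + r * r      ≈⟨ +-congʳ (x^[2M+1]≈x*x^M*x^M z) ⟩
      z * (z ^ M * z ^ M) + r * r  ∎)
      where b′ = y′ ^ suc (M ℕ.* 2)

    -- The variables stand for 1/(2D), 1/(2R), d/(2RD) and u²/D, with R = r².
    module _ {i j k τ : Carrier}
      (i*2D≈1 : i * ((1# + 1#) * D) ≈ 1#) (j*2R≈1 : j * ((1# + 1#) * (r * r)) ≈ 1#)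
      (k*2RD≈d : k * ((1# + 1#) * (r * r) * D) ≈ d) (τ*D≈u² : τ * D ≈ u * u) where
      private
        x = - 1# * τ
        S = lucasSum x m
        A = j * S + (- 1#) ^ suc M * k * u
        P = - 1# * (y * y)
        Q = - 1# * (y′ * y′)

        -- Multiplied by the unit D, both sides become z^p s².
        z*τ≈s² : z * τ ≈ s * s
        z*τ≈s² = cancel
          (trans (solve 2 (λ i D → i :* con 2 :* D := i :* (con 2 :* D)) refl i D) i*2D≈1)
          (begin
            D * (z * τ)                     ≈⟨ solve 3 (λ D z t → D :* (z :* t) := z :* (t :* D)) refl D z τ ⟩
            z * (τ * D)                     ≈⟨ *-congˡ τ*D≈u² ⟩
            z * (z ^ M * s * (z ^ M * s))   ≈⟨ solve 3 (λ z t s → z :* (t :* s :* (t :* s)) := z :* (t :* t) :* (s :* s)) refl z (z ^ M) s ⟩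
            z * (z ^ M * z ^ M) * (s * s)   ≈⟨ *-congʳ D≈z^p ⟨
            D * (s * s)                     ∎)

        trace : z * (1# + 1# + x) ≈ P + Q
        trace = begin
          z * (1# + 1# + - 1# * τ)
            ≈⟨ solve 3 (λ n z t → z :* (con 2 :+ n :* t) := n :* (z :* t) :+ con 2 :* z) refl (- 1#) z τ ⟩
          - 1# * (z * τ) + (1# + 1#) * z   ≈⟨ +-congʳ (*-congˡ z*τ≈s²) ⟩
          - 1# * (s * s) + (1# + 1#) * z
            ≈⟨ solve 3 (λ n y y′ → n :* ((y :+ y′) :* (y :+ y′)) :+ con 2 :* (y :* y′) :=
                  n :* (y :* y) :+ n :* (y′ :* y′) :+ (n :* (con 2 :* (y :* y′)) :+ con 2 :* (y :* y′)))
                refl (- 1#) y y′ ⟩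
          P + Q + (- 1# * ((1# + 1#) * z) + (1# + 1#) * z)  ≈⟨ +-congˡ (-1*x+x≈0 _) ⟩
          P + Q + 0#                                        ≈⟨ +-identityʳ _ ⟩
          P + Q                                             ∎

        norm : z * z ≈ P * Q
        norm = begin
          z * z                    ≈⟨ *-identityˡ _ ⟨
          1# * (z * z)             ≈⟨ *-congʳ -1*-1≈1 ⟨
          - 1# * - 1# * (z * z)
            ≈⟨ solve 3 (λ n y y′ → n :* n :* (y :* y′ :* (y :* y′)) := n :* (y :* y) :* (n :* (y′ :* y′)))
                refl (- 1#) y y′ ⟩
          P * Q                    ∎

        -- The extra factor z = v v′ completes v^(2M) to v^p and leaves one v′; this accounts for
        -- the exponent M + 1 in `w`.
        z*P^M≈ : ∀ v v′ → v * v′ ≈ z →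
                 z * (- 1# * (v * v)) ^ M ≈ μ * (v′ * v ^ suc (M ℕ.* 2))
        z*P^M≈ v v′ vv′≈z = begin
          z * (- 1# * (v * v)) ^ M
            ≈⟨ *-cong (sym vv′≈z) (trans (^-distrib-* (- 1#) (v * v) M) (*-congˡ (^-distrib-* v v M))) ⟩
          v * v′ * (μ * (v ^ M * v ^ M))
            ≈⟨ solve 4 (λ v v′ n a → v :* v′ :* (n :* (a :* a)) := n :* (v′ :* (v :* (a :* a))))
                refl v v′ μ (v ^ M) ⟩
          μ * (v′ * (v * (v ^ M * v ^ M)))   ≈⟨ *-congˡ (*-congˡ (x^[2M+1]≈x*x^M*x^M v)) ⟨
          μ * (v′ * v ^ suc (M ℕ.* 2))         ∎

        z*z^M*S≈ : z * (z ^ M * S) ≈ μ * (y′ * (d + r) + y * y′ ^ suc (M ℕ.* 2))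
        z*z^M*S≈ = begin
          z * (z ^ M * S)        ≈⟨ *-congˡ (z^[m+1]*lucasSum≈P^[m+1]+Q^[m+1] x trace norm m) ⟩
          z * (P ^ M + Q ^ M)    ≈⟨ distribˡ z _ _ ⟩
          z * P ^ M + z * Q ^ M  ≈⟨ +-cong (z*P^M≈ y y′ refl) (z*P^M≈ y′ y (*-comm y′ y)) ⟩
          μ * (y′ * y ^ suc (M ℕ.* 2)) + μ * (y * y′ ^ suc (M ℕ.* 2))
            ≈⟨ +-congʳ (*-congˡ (*-congˡ y^p≈d+r)) ⟩
          μ * (y′ * (d + r)) + μ * (y * y′ ^ suc (M ℕ.* 2))  ≈⟨ distribˡ μ _ _ ⟨
          μ * (y′ * (d + r) + y * y′ ^ suc (M ℕ.* 2))        ∎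

        -- Since y′^p = d - r, the first two summands are d s + r (y′ - y); the linear term of A
        -- supplies the -d s.
        difference : y′ * (d + r) + y * y′ ^ suc (M ℕ.* 2) + - 1# * (d * s) ≈ r * (y′ + - 1# * y)
        difference = begin
          y′ * (d + r) + y * b′ + - 1# * (d * s)
            ≈⟨ +-identityʳ _ ⟨
          y′ * (d + r) + y * b′ + - 1# * (d * s) + 0#
            -- This zero provides the y r that completes y b′ to (b′ + r) y = d y.
            ≈⟨ +-congˡ (-1*x+x≈0 (y * r)) ⟨
          y′ * (d + r) + y * b′ + - 1# * (d * s) + (- 1# * (y * r) + y * r)
            ≈⟨ solve 7 (λ n y y′ d r b e →
                  y′ :* (d :+ r) :+ y :* b :+ e :+ (n :* (y :* r) :+ y :* r) :=
                  r :* (y′ :+ n :* y) :+ (e :+ (d :* y′ :+ (b :+ r) :* y)))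
                refl (- 1#) y y′ d r b′ (- 1# * (d * s)) ⟩
          r * (y′ + - 1# * y) + (- 1# * (d * s) + (d * y′ + (b′ + r) * y))
            ≈⟨ +-congˡ (+-congˡ (+-congˡ (*-congʳ y′^p+r≈d))) ⟩
          r * (y′ + - 1# * y) + (- 1# * (d * s) + (d * y′ + d * y))
            ≈⟨ +-congˡ (+-congˡ (trans (sym (distribˡ d y′ y)) (*-congˡ (+-comm y′ y)))) ⟩
          r * (y′ + - 1# * y) + (- 1# * (d * s) + d * s)
            ≈⟨ +-congˡ (-1*x+x≈0 (d * s)) ⟩
          r * (y′ + - 1# * y) + 0#
            ≈⟨ +-identityʳ _ ⟩
          r * (y′ + - 1# * y) ∎
          where b′ = y′ ^ suc (M ℕ.* 2)

      -- The powers of z in w and u multiply to z^(2M+1) = D, which `i` cancels together with the 2.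
      2*w*u*i≈y+y′ : (1# + 1#) * (w * (u * i)) ≈ y + y′
      2*w*u*i≈y+y′ = begin
        (1# + 1#) * (z * z ^ M * (z ^ M * s * i))
          ≈⟨ solve 4 (λ z t s i → con 2 :* (z :* t :* (t :* s :* i)) := i :* (con 2 :* (z :* (t :* t))) :* s)
              refl z (z ^ M) s i ⟩
        i * ((1# + 1#) * (z * (z ^ M * z ^ M))) * s  ≈⟨ *-congʳ (*-congˡ (*-congˡ D≈z^p)) ⟨
        i * ((1# + 1#) * D) * s                      ≈⟨ *-congʳ i*2D≈1 ⟩
        1# * s                                       ≈⟨ *-identityˡ s ⟩
        y + y′                                       ∎

      2*w*A*r≈±[y′-y] : (1# + 1#) * (w * (A * r)) ≈ μ * (y′ + - 1# * y)
      2*w*A*r≈±[y′-y] = cancel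
        (trans (solve 2 (λ j R → j :* con 2 :* R := j :* (con 2 :* R)) refl j (r * r)) j*2R≈1)
        (begin
          -- The factor r² = R clears the denominators of both `j` and `k`; the D needed for `k`
          -- comes from w u = z^p s. The r in A r and the r produced by `difference` restore r², a
          -- unit with inverse 2j.
          r * r * ((1# + 1#) * (z * z ^ M * ((j * S + - 1# * μ * k * u) * r)))
            ≈⟨ solve 9 (λ r z t j S n μ k s →
                  r :* r :* (con 2 :* (z :* t :* ((j :* S :+ n :* μ :* k :* (t :* s)) :* r))) :=
                  j :* (con 2 :* (r :* r)) :* (z :* (t :* S)) :* r
                    :+ n :* (μ :* (k :* (con 2 :* (r :* r) :* (z :* (t :* t))) :* s :* r)))
                refl r z (z ^ M) j S (- 1#) μ k s ⟩
          j * ((1# + 1#) * (r * r)) * (z * (z ^ M * S)) * r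
            + - 1# * (μ * (k * ((1# + 1#) * (r * r) * (z * (z ^ M * z ^ M))) * s * r))
            ≈⟨ +-cong (*-congʳ (*-cong j*2R≈1 z*z^M*S≈))
                 (*-congˡ (*-congˡ (*-congʳ (*-congʳ (trans (*-congˡ (*-congˡ (sym D≈z^p))) k*2RD≈d))))) ⟩
          1# * (μ * (y′ * (d + r) + y * b′)) * r + - 1# * (μ * (d * s * r))
            ≈⟨ solve 6 (λ μ e r n d s → con 1 :* (μ :* e) :* r :+ n :* (μ :* (d :* s :* r)) :=
                                        μ :* r :* (e :+ n :* (d :* s)))
                refl μ (y′ * (d + r) + y * b′) r (- 1#) d s ⟩
          μ * r * (y′ * (d + r) + y * b′ + - 1# * (d * s))  ≈⟨ *-congˡ difference ⟩
          μ * r * (r * (y′ + - 1# * y))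
            ≈⟨ solve 3 (λ μ r v → μ :* r :* (r :* v) := r :* r :* (μ :* v)) refl μ r (y′ + - 1# * y) ⟩
          r * r * (μ * (y′ + - 1# * y))                     ∎)
        where b′ = y′ ^ suc (M ℕ.* 2)

-- Halving the odd exponent, and arithmetic in a field.

odd⇒half : ∀ p → 3 ℕ.≤ p → ¬ 2 ∣ p → ∃[ m ] p ≡ suc (suc m ℕ.* 2)
odd⇒half p 3≤p 2∤p with p ℕ.% 2 in r | p ℕ./ 2 in q | ℕ.m≡m%n+[m/n]*n p 2 | ℕ.m%n<n p 2
... | 0 | _     | _  | _ = ⊥-elim (2∤p (m%n≡0⇒n∣m p 2 r))
... | 1 | suc m | eq | _ = m , eq
... | 1 | zero  | eq | _ with ≡.subst (3 ℕ.≤_) eq 3≤p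
...   | s≤s ()
odd⇒half p 3≤p 2∤p | suc (suc _) | _ | _ | s≤s (s≤s ())

m*2/2≡m : ∀ m → m ℕ.* 2 ℕ./ 2 ≡ m
m*2/2≡m m = ℕ.m*n/n≡m m 2

[p∸1]/2≡m : ∀ m {p} → p ≡ suc (m ℕ.* 2) → (p ℕ.∸ 1) ℕ./ 2 ≡ m
[p∸1]/2≡m m ≡.refl = m*2/2≡m m

[p+1]/2≡1+m : ∀ m {p} → p ≡ suc (m ℕ.* 2) → (p ℕ.+ 1) ℕ./ 2 ≡ suc m
[p+1]/2≡1+m m ≡.refl =
  ≡.trans (≡.cong (λ n → suc n ℕ./ 2) (ℕ.+-comm (m ℕ.* 2) 1)) (m*2/2≡m (suc m))

module FieldProperties {c ℓ} (F : Field c ℓ) where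
  open Field F hiding (zero)
  open Algebra.Properties.Semiring.Mult semiring using (×1-homo-*)
  open SignProperties commutativeRing
  open Algebra.Solver.Ring.NaturalCoefficients.Default commutativeSemiring
    using (solve; con; _:+_; _:*_; _:=_)
  open Relation.Binary.Reasoning.Setoid setoid

  [x/y]*y≈x : ∀ x y (y≉0 : y ≉ 0#) → (x / y [ y≉0 ]) * y ≈ x
  [x/y]*y≈x x y y≉0 = begin
    x * y⁻¹ * y    ≈⟨ *-assoc x y⁻¹ y ⟩
    x * (y⁻¹ * y)  ≈⟨ *-congˡ (proj₁ (proj₂ (≉0⇒invertible y y≉0))) ⟩
    x * 1#         ≈⟨ *-identityʳ x ⟩
    x              ∎
    where y⁻¹ = proj₁ (≉0⇒invertible y y≉0)

  -- Cancelling b leaves an identity of natural numbers, so a quotient formed in the field is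
  -- recognised as the image of a natural number.
  fromℕ-ratio : ∀ a b c e (b≉0 : fromℕ b ≉ 0#) → b ℕ.* e ≡ a ℕ.* c →
    (fromℕ a / fromℕ b [ b≉0 ]) * fromℕ c ≈ fromℕ e
  fromℕ-ratio a b c e b≉0 be≡ac = *-cancelˡ-≉0 (fromℕ b) b≉0 (begin
    fromℕ b * (q * fromℕ c)  ≈⟨ *-assoc _ _ _ ⟨
    fromℕ b * q * fromℕ c    ≈⟨ *-congʳ (trans (*-comm _ _) ([x/y]*y≈x (fromℕ a) (fromℕ b) b≉0)) ⟩
    fromℕ a * fromℕ c        ≈⟨ ×1-homo-* a c ⟨
    fromℕ (a ℕ.* c)          ≡⟨ ≡.cong fromℕ be≡ac ⟨
    fromℕ (b ℕ.* e)          ≈⟨ ×1-homo-* b e ⟩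
    fromℕ b * fromℕ e        ∎)
    where q = fromℕ a / fromℕ b [ b≉0 ]

  [-1]^n≈±1 : ∀ n → (- 1#) ^ n ≈ 1# ⊎ (- 1#) ^ n ≈ - 1#
  [-1]^n≈±1 zero    = inj₁ refl
  [-1]^n≈±1 (suc n) with [-1]^n≈±1 n
  ... | inj₁ eq = inj₂ (trans (*-congˡ eq) (*-identityʳ (- 1#)))
  ... | inj₂ eq = inj₁ (trans (*-congˡ eq) -1*-1≈1)

  half-sums : ∀ {w a b x y} → 1# + 1# ≉ 0# →
    (1# + 1#) * (w * a) ≈ x + y → (1# + 1#) * (w * b) ≈ x + - 1# * y →
    x ≈ w * (a + b) × y ≈ w * (a - b)
  half-sums {w} {a} {b} {x} {y} 2≉0 2wa≈x+y 2wb≈x-y =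
      *-cancelˡ-≉0 _ 2≉0 (begin
        (1# + 1#) * x                           ≈⟨ +-identityʳ _ ⟨
        (1# + 1#) * x + 0#                      ≈⟨ +-congˡ (-1*x+x≈0 y) ⟨
        (1# + 1#) * x + (- 1# * y + y)
          ≈⟨ solve 3 (λ x y z → con 2 :* x :+ (z :+ y) := x :+ y :+ (x :+ z)) refl x y (- 1# * y) ⟩
        x + y + (x + - 1# * y)                  ≈⟨ +-cong 2wa≈x+y 2wb≈x-y ⟨
        (1# + 1#) * (w * a) + (1# + 1#) * (w * b)
          ≈⟨ solve 3 (λ w a b → con 2 :* (w :* a) :+ con 2 :* (w :* b) := con 2 :* (w :* (a :+ b))) refl w a b ⟩
        (1# + 1#) * (w * (a + b))               ∎)
    -- Adding x - y = 2wb to both sides reduces the second equation to 2y + (x - y) = x + y.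
    , *-cancelˡ-≉0 _ 2≉0 (+-cancelʳ (x + - 1# * y) _ _ (begin
        (1# + 1#) * y + (x + - 1# * y)
          ≈⟨ solve 3 (λ x y z → con 2 :* y :+ (x :+ z) := x :+ y :+ (z :+ y)) refl x y (- 1# * y) ⟩
        x + y + (- 1# * y + y)                  ≈⟨ trans (+-congˡ (-1*x+x≈0 y)) (+-identityʳ _) ⟩
        x + y                                   ≈⟨ 2wa≈x+y ⟨
        (1# + 1#) * (w * a)                     ≈⟨ +-identityʳ _ ⟨
        (1# + 1#) * (w * a) + 0#
          ≈⟨ +-congˡ (trans (*-congˡ (trans (*-congˡ (-‿inverseˡ b)) (zeroʳ w))) (zeroʳ _)) ⟨
        (1# + 1#) * (w * a) + (1# + 1#) * (w * (- b + b))
          ≈⟨ solve 4 (λ w a b c → con 2 :* (w :* a) :+ con 2 :* (w :* (c :+ b)) :=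
                con 2 :* (w :* (a :+ c)) :+ con 2 :* (w :* b)) refl w a b (- b) ⟩
        (1# + 1#) * (w * (a - b)) + (1# + 1#) * (w * b)  ≈⟨ +-congˡ 2wb≈x-y ⟩
        (1# + 1#) * (w * (a - b)) + (x + - 1# * y)       ∎))
    where open Algebra.Properties.Group +-group using () renaming (∙-cancelʳ to +-cancelʳ)

  pair-swap : ∀ {a b a′ b′} → a ≈ b′ → b ≈ a′ → pair a b ≐ pair a′ b′
  pair-swap a≈b′ b≈a′ =
      (λ { (inj₁ e) → inj₂ (trans e a≈b′)       ; (inj₂ e) → inj₁ (trans e b≈a′) })
    , (λ { (inj₁ e) → inj₂ (trans e (sym b≈a′)) ; (inj₂ e) → inj₁ (trans e (sym a≈b′)) })

  pair-cong : ∀ {a b a′ b′} → a ≈ a′ → b ≈ b′ → pair a b ≐ pair a′ b′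
  pair-cong a≈a′ b≈b′ =
      (λ { (inj₁ e) → inj₁ (trans e a≈a′)       ; (inj₂ e) → inj₂ (trans e b≈b′) })
    , (λ { (inj₁ e) → inj₁ (trans e (sym a≈a′)) ; (inj₂ e) → inj₂ (trans e (sym b≈b′)) })

  -- The unordered pair absorbs the parity of M: for μ = 1 the plus sign yields y, for μ = -1 it
  -- yields x.
  pair≐half-sums : ∀ {w a b x y μ} → 1# + 1# ≉ 0# → μ ≈ 1# ⊎ μ ≈ - 1# →
    (1# + 1#) * (w * a) ≈ x + y → (1# + 1#) * (w * b) ≈ μ * (y + - 1# * x) →
    pair x y ≐ pair (w * (a + b)) (w * (a - b))
  pair≐half-sums {x = x} {y} 2≉0 (inj₁ μ≈1) sum diff = pair-swap (proj₂ halves) (proj₁ halves)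
    where halves = half-sums 2≉0 (trans sum (+-comm x y)) (trans diff (trans (*-congʳ μ≈1) (*-identityˡ _)))
  pair≐half-sums {x = x} {y} {μ} 2≉0 (inj₂ μ≈-1) sum diff = pair-cong (proj₁ halves) (proj₂ halves)
    where
    halves = half-sums 2≉0 sum (begin
      _                          ≈⟨ diff ⟩
      μ * (y + - 1# * x)         ≈⟨ *-congʳ μ≈-1 ⟩
      - 1# * (y + - 1# * x)
        ≈⟨ solve 3 (λ n x y → n :* (y :+ n :* x) := n :* n :* x :+ n :* y) refl (- 1#) x y ⟩
      - 1# * - 1# * x + - 1# * y  ≈⟨ +-congʳ (*-congʳ -1*-1≈1) ⟩
      1# * x + - 1# * y          ≈⟨ +-congʳ (*-identityˡ x) ⟩
      x + - 1# * y               ∎)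

module _ {c ℓ} (K : Field c ℓ) (char0 : CharacteristicZero K) (p : ℕ) (3≤p : 3 ℕ.≤ p) where
  open Field K
  open FieldProperties K

  a₂ₖ≈±lucas : ∀ m → p ≡ suc (suc m ℕ.* 2) → ∀ k →
    a₂ₖ K char0 p 3≤p k ≈ (- 1#) ^ k * fromℕ (lucas m k)
  a₂ₖ≈±lucas m ≡.refl k = trans (*-assoc _ _ _) (*-congˡ
    (fromℕ-ratio (p ℕ.∸ 1) (p∸1/2 ℕ.+ k) ((p∸1/2 ℕ.+ k) C (2 ℕ.* k)) (lucas m k) _ ratio))
    where
    p∸1/2 = (p ℕ.∸ 1) ℕ./ 2
    ratio : (p∸1/2 ℕ.+ k) ℕ.* lucas m k ≡ (p ℕ.∸ 1) ℕ.* ((p∸1/2 ℕ.+ k) C (2 ℕ.* k))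
    ratio rewrite m*2/2≡m (suc m) =
      ≡.trans (lucas-ratio m k) (≡.cong (ℕ._* ((suc m ℕ.+ k) C (2 ℕ.* k))) (ℕ.*-comm 2 (suc m)))

-- Evaluation of polynomials along a homomorphism.

-- Coefficient lists are only a raw ring, so compatibility with the operations is proved by
-- recursion on lists. With base change along `ι` built in, the identity homomorphism covers h and
-- h′, whose coefficients already lie in L.
module Evaluation {c ℓ c′ ℓ′} {K : Field c ℓ} {L : Field c′ ℓ′}
  {ι : Field.Carrier K → Field.Carrier L}
  (isHom : RingMorphisms.IsRingHomomorphism (Field.rawRing K) (Field.rawRing L) ι)
  (x : Field.Carrier L) where
  private
    module K    = Field K
    module K[Z] = Polynomial K
    open Field L hiding (zero)
    open RingMorphisms.IsRingHomomorphism isHom using (+-homo; *-homo; -‿homo; 0#-homo; 1#-homo)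
    open Algebra.Properties.Ring ring using (-0#≈0#; -‿distribʳ-*; -‿+-comm)
    open Algebra.Properties.Semiring.Sum semiring using (sum)
    open Algebra.Solver.Ring.NaturalCoefficients.Default commutativeSemiring
      using (solve; con; _:+_; _:*_; _:=_)
    open Relation.Binary.Reasoning.Setoid setoid

  ⟦_⟧ : K[Z].Poly → Carrier
  ⟦ f ⟧ = Polynomial.eval L (map ι f) x

  eval-const : ∀ a → ⟦ K[Z].const a ⟧ ≈ ι a
  eval-const a = trans (+-congˡ (zeroʳ x)) (+-identityʳ (ι a))

  eval-Z : ⟦ K[Z].Z ⟧ ≈ x
  eval-Z = begin
    ι K.0# + x * (ι K.1# + x * 0#)  ≈⟨ +-cong 0#-homo (*-congˡ (+-congʳ 1#-homo)) ⟩
    0# + x * (1# + x * 0#)          ≈⟨ solve 1 (λ x → con 0 :+ x :* (con 1 :+ x :* con 0) := x) refl x ⟩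
    x                               ∎

  eval-+ : ∀ f g → ⟦ f K[Z].+ g ⟧ ≈ ⟦ f ⟧ + ⟦ g ⟧
  eval-+ []      g       = sym (+-identityˡ ⟦ g ⟧)
  eval-+ (a ∷ f) []      = sym (+-identityʳ ⟦ a ∷ f ⟧)
  eval-+ (a ∷ f) (b ∷ g) = begin
    ι (a K.+ b) + x * ⟦ f K[Z].+ g ⟧      ≈⟨ +-cong (+-homo a b) (*-congˡ (eval-+ f g)) ⟩
    ι a + ι b + x * (⟦ f ⟧ + ⟦ g ⟧)
      ≈⟨ solve 5 (λ a b x f g → a :+ b :+ x :* (f :+ g) := a :+ x :* f :+ (b :+ x :* g))
           refl (ι a) (ι b) x ⟦ f ⟧ ⟦ g ⟧ ⟩
    ι a + x * ⟦ f ⟧ + (ι b + x * ⟦ g ⟧)   ∎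

  eval-scale : ∀ a f → ⟦ map (a K.*_) f ⟧ ≈ ι a * ⟦ f ⟧
  eval-scale a []      = sym (zeroʳ (ι a))
  eval-scale a (b ∷ f) = begin
    ι (a K.* b) + x * ⟦ map (a K.*_) f ⟧  ≈⟨ +-cong (*-homo a b) (*-congˡ (eval-scale a f)) ⟩
    ι a * ι b + x * (ι a * ⟦ f ⟧)
      ≈⟨ solve 4 (λ a b x f → a :* b :+ x :* (a :* f) := a :* (b :+ x :* f)) refl (ι a) (ι b) x ⟦ f ⟧ ⟩
    ι a * (ι b + x * ⟦ f ⟧)               ∎

  eval-* : ∀ f g → ⟦ f K[Z].* g ⟧ ≈ ⟦ f ⟧ * ⟦ g ⟧
  eval-* []      g = sym (zeroˡ ⟦ g ⟧)
  eval-* (a ∷ f) g = begin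
    ⟦ map (a K.*_) g K[Z].+ (K.0# ∷ f K[Z].* g) ⟧
      ≈⟨ eval-+ (map (a K.*_) g) _ ⟩
    ⟦ map (a K.*_) g ⟧ + (ι K.0# + x * ⟦ f K[Z].* g ⟧)
      ≈⟨ +-cong (eval-scale a g) (+-cong 0#-homo (*-congˡ (eval-* f g))) ⟩
    ι a * ⟦ g ⟧ + (0# + x * (⟦ f ⟧ * ⟦ g ⟧))
      ≈⟨ solve 4 (λ a x f g → a :* g :+ (con 0 :+ x :* (f :* g)) := (a :+ x :* f) :* g) refl (ι a) x ⟦ f ⟧ ⟦ g ⟧ ⟩
    (ι a + x * ⟦ f ⟧) * ⟦ g ⟧ ∎

  eval-neg : ∀ f → ⟦ K[Z].- f ⟧ ≈ - ⟦ f ⟧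
  eval-neg []      = sym -0#≈0#
  eval-neg (a ∷ f) = begin
    ι (K.- a) + x * ⟦ K[Z].- f ⟧  ≈⟨ +-cong (-‿homo a) (*-congˡ (eval-neg f)) ⟩
    - ι a + x * - ⟦ f ⟧           ≈⟨ +-congˡ (-‿distribʳ-* x ⟦ f ⟧) ⟨
    - ι a - x * ⟦ f ⟧             ≈⟨ -‿+-comm (ι a) _ ⟩
    - (ι a + x * ⟦ f ⟧)           ∎

  eval-^ : ∀ f n → ⟦ f K[Z].^ n ⟧ ≈ ⟦ f ⟧ ^ n
  eval-^ f zero    = trans (eval-const K.1#) 1#-homo
  eval-^ f (suc n) = trans (eval-* f (f K[Z].^ n)) (*-congˡ (eval-^ f n))

  eval-Z^ : ∀ n → ⟦ K[Z].Z K[Z].^ n ⟧ ≈ x ^ n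
  eval-Z^ n = trans (eval-^ K[Z].Z n) (Algebra.Properties.CommutativeSemiring.Exp.^-congˡ commutativeSemiring n eval-Z)

  eval-sum : ∀ {n} (f : Fin n → K[Z].Poly) → ⟦ K[Z].sum f ⟧ ≈ sum (λ i → ⟦ f i ⟧)
  eval-sum {zero}  f = refl
  eval-sum {suc n} f = trans (eval-+ (f zero) _) (+-congˡ (eval-sum (λ i → f (suc i))))

module HomProperties {c ℓ c′ ℓ′} {K : Field c ℓ} {L : Field c′ ℓ′}
  {ι : Field.Carrier K → Field.Carrier L}
  (isHom : RingMorphisms.IsRingHomomorphism (Field.rawRing K) (Field.rawRing L) ι) where
  private
    module K = Field K
    module L = Field L
  open RingMorphisms.IsRingHomomorphism isHom

  ι-^ : ∀ x n → ι (x K.^ n) L.≈ ι x L.^ n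
  ι-^ x zero    = 1#-homo
  ι-^ x (suc n) = L.trans (*-homo x (x K.^ n)) (L.*-congˡ (ι-^ x n))

  ι-fromℕ : ∀ n → ι (K.fromℕ n) L.≈ L.fromℕ n
  ι-fromℕ zero    = 0#-homo
  ι-fromℕ (suc n) = L.trans (+-homo K.1# (K.fromℕ n)) (L.+-cong 1#-homo (ι-fromℕ n))

  ι-[-1]^ : ∀ n → ι ((K.- K.1#) K.^ n) L.≈ (L.- L.1#) L.^ n
  ι-[-1]^ n = L.trans (ι-^ (K.- K.1#) n)
    (^-congˡ n (L.trans (-‿homo K.1#) (L.-‿cong 1#-homo)))
    where open Algebra.Properties.CommutativeSemiring.Exp L.commutativeSemiring using (^-congˡ)

  ι-/ : ∀ x y (y≉0 : y K.≉ K.0#) → ι (x K./ y [ y≉0 ]) L.* ι y L.≈ ι x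
  ι-/ x y y≉0 = L.trans (L.sym (*-homo _ y)) (⟦⟧-cong (FieldProperties.[x/y]*y≈x K x y y≉0))

  ι-2 : ι (K.fromℕ 2) L.≈ L.1# L.+ L.1#
  ι-2 = L.trans (ι-fromℕ 2) (L.+-congˡ (L.+-identityʳ L.1#))

module _ {c ℓ} (L : Field c ℓ) where
  open Field L
  open Algebra.Properties.Group +-group using () renaming (x∙y⁻¹≈ε⇒x≈y to x-y≈0⇒x≈y)
  open Algebra.Solver.Ring.NaturalCoefficients.Default commutativeSemiring
    using (solve; con; _:+_; _:*_; _:=_)
  open Relation.Binary.Reasoning.Setoid setoid

  private
    module L[Z] = Polynomial L
    module Eval = Evaluation {K = L} {L = L} (Identity.isRingHomomorphism rawRing refl)

    eval≈ : ∀ f x → L[Z].eval f x ≈ Eval.⟦_⟧ x f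
    eval≈ f x = reflexive (≡.cong (λ g → L[Z].eval g x) (≡.sym (map-id f)))

    eval-Z^p-d : ∀ p d x → Eval.⟦_⟧ x (L[Z].Z L[Z].^ p L[Z].- L[Z].const d) ≈ x ^ p - d
    eval-Z^p-d p d x = trans (Eval.eval-+ x (L[Z].Z L[Z].^ p) _)
      (+-cong (Eval.eval-Z^ x p) (trans (Eval.eval-neg x (L[Z].const d)) (-‿cong (Eval.eval-const x d))))

  hPoly-zero : ∀ p d r y → L[Z].IsZeroOf y (hPoly L p d r) → y ^ p ≈ d + r
  hPoly-zero p d r y h[y]≈0 = x-y≈0⇒x≈y (y ^ p) (d + r) (begin
    y ^ p - (d + r)        ≈⟨ +-congˡ (-‿+-comm d r) ⟨
    y ^ p + (- d - r)      ≈⟨ +-assoc _ _ _ ⟨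
    y ^ p - d - r
      ≈⟨ +-cong (eval-Z^p-d p d y) (trans (Eval.eval-neg y (L[Z].const r)) (-‿cong (Eval.eval-const y r))) ⟨
    _                      ≈⟨ Eval.eval-+ y (L[Z].Z L[Z].^ p L[Z].- L[Z].const d) _ ⟨
    _                      ≈⟨ eval≈ (hPoly L p d r) y ⟨
    L[Z].eval (hPoly L p d r) y  ≈⟨ h[y]≈0 ⟩
    0#                     ∎)
    where open Algebra.Properties.Ring ring using (-‿+-comm)

  h′Poly-zero : ∀ p d r y → L[Z].IsZeroOf y (h′Poly L p d r) → y ^ p + r ≈ d
  h′Poly-zero p d r y h′[y]≈0 = x-y≈0⇒x≈y (y ^ p + r) d (begin
    y ^ p + r - d
      ≈⟨ solve 3 (λ a b c → a :+ b :+ c := a :+ c :+ b) refl (y ^ p) r (- d) ⟩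
    y ^ p - d + r          ≈⟨ +-cong (eval-Z^p-d p d y) (Eval.eval-const y r) ⟨
    _                      ≈⟨ Eval.eval-+ y (L[Z].Z L[Z].^ p L[Z].- L[Z].const d) _ ⟨
    _                      ≈⟨ eval≈ (h′Poly L p d r) y ⟨
    L[Z].eval (h′Poly L p d r) y  ≈⟨ h′[y]≈0 ⟩
    0#                     ∎)

-- The value of A at u.

module _ {c ℓ c′ ℓ′} {K : Field c ℓ} (char0 : CharacteristicZero K)
  (K̄ : AlgebraicClosure K c′ ℓ′) (p : ℕ) (3≤p : 3 ℕ.≤ p)
  (d R : Field.Carrier K) (R≉0 : Field._≉_ K R (Field.0# K))
  (D≉0 : Field._≉_ K (disc K d R) (Field.0# K)) where
  private
    L = AlgebraicClosure.closure K̄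
    module K    = Field K
    module K[Z] = Polynomial K
    module MV   = MorganVoyce (Field.commutativeRing L)
    open AlgebraicClosure K̄ using (ι; isRingHomomorphism; *-homo; ⟦⟧-cong)
    open Field L hiding (zero)
    open Algebra.Properties.Semiring.Mult semiring using (×-assoc-*; ×-congʳ)
    open Algebra.Properties.CommutativeSemiring.Exp commutativeSemiring using (^-congˡ; ^-assocʳ; ^-distrib-*)
    open Algebra.Properties.Semiring.Sum semiring using (sum; sum-cong-≋)
    open Algebra.Solver.Ring.NaturalCoefficients.Default commutativeSemiring
      using (solve; con; _:+_; _:*_; _:=_)
    open Relation.Binary.Reasoning.Setoid setoid
    open HomProperties {K = K} {L = L} isRingHomomorphism
    D = disc K d R
    a = a₂ₖ K char0 p 3≤p

  ιD≉0 : ι D ≉ 0#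
  ιD≉0 ιD≈0 = 1≉0 (begin
    1#                             ≈⟨ AlgebraicClosure.1#-homo K̄ ⟨
    ι K.1#                         ≈⟨ ι-/ K.1# D D≉0 ⟨
    ι (K.1# K./ D [ D≉0 ]) * ι D   ≈⟨ trans (*-congˡ ιD≈0) (zeroʳ _) ⟩
    0#                             ∎)

  -- Since u^(2k) = τ^k D^k, the denominator D^k cancels, and the sign (-1)^k of a₂ₖ joins τ^k to
  -- form (-τ)^k. Hence -τ is the argument of the Morgan-Voyce polynomials.
  APoly-term : ∀ m → p ≡ suc (suc m ℕ.* 2) → ∀ u τ → τ * ι D ≈ u * u → ∀ k →
    ι (a k K./ D K.^ k [ K.^-≉0 D≉0 k ]) * u ^ (2 ℕ.* k) ≈ lucas m k · (- 1# * τ) ^ k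
  APoly-term m p≡ u τ τD≈u² k = *-cancelˡ-≉0 (ι D ^ k) (^-≉0 ιD≉0 k) (begin
    ι D ^ k * (ι q * u ^ (2 ℕ.* k))
      ≈⟨ solve 3 (λ D q u → D :* (q :* u) := q :* D :* u) refl (ι D ^ k) (ι q) _ ⟩
    ι q * ι D ^ k * u ^ (2 ℕ.* k)
      ≈⟨ *-congʳ (*-congˡ (ι-^ D k)) ⟨
    ι q * ι (D K.^ k) * u ^ (2 ℕ.* k)
      ≈⟨ *-congʳ (ι-/ (a k) (D K.^ k) _) ⟩
    ι (a k) * u ^ (2 ℕ.* k)
      ≈⟨ *-cong (⟦⟧-cong (a₂ₖ≈±lucas K char0 p 3≤p m p≡ k)) u^2k ⟩
    ι ((K.- K.1#) K.^ k K.* K.fromℕ (lucas m k)) * (τ ^ k * ι D ^ k)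
      ≈⟨ *-congʳ (trans (*-homo _ _) (*-cong (ι-[-1]^ k) (ι-fromℕ (lucas m k)))) ⟩
    (- 1#) ^ k * fromℕ (lucas m k) * (τ ^ k * ι D ^ k)
      ≈⟨ solve 4 (λ n l t D → n :* l :* (t :* D) := D :* (l :* (n :* t)))
           refl ((- 1#) ^ k) (fromℕ (lucas m k)) (τ ^ k) (ι D ^ k) ⟩
    ι D ^ k * (fromℕ (lucas m k) * ((- 1#) ^ k * τ ^ k))
      ≈⟨ *-congˡ (*-congˡ (^-distrib-* (- 1#) τ k)) ⟨
    ι D ^ k * (fromℕ (lucas m k) * (- 1# * τ) ^ k)
      ≈⟨ *-congˡ (×-assoc-* (lucas m k) 1# _) ⟩
    ι D ^ k * (lucas m k · (1# * (- 1# * τ) ^ k))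
      ≈⟨ *-congˡ (×-congʳ (lucas m k) (*-identityˡ _)) ⟩
    ι D ^ k * (lucas m k · (- 1# * τ) ^ k) ∎)
    where
    q = a k K./ D K.^ k [ K.^-≉0 D≉0 k ]
    u^2k : u ^ (2 ℕ.* k) ≈ τ ^ k * ι D ^ k
    u^2k = begin
      u ^ (2 ℕ.* k)     ≈⟨ ^-assocʳ u 2 k ⟨
      (u ^ 2) ^ k       ≈⟨ ^-congˡ k (trans (*-congˡ (*-identityʳ u)) (sym τD≈u²)) ⟩
      (τ * ι D) ^ k     ≈⟨ ^-distrib-* τ (ι D) k ⟩
      τ ^ k * ι D ^ k   ∎

  private
    A    = APoly K char0 p 3≤p d R R≉0 D≉0
    2R≉0 = K.*-≉0 (fromℕ≉0 K char0 2) R≉0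

  eval-APoly : ∀ m → p ≡ suc (suc m ℕ.* 2) → ∀ u τ → τ * ι D ≈ u * u →
    AlgebraicClosure.evalAt K̄ A u ≈
      ι (K.1# K./ (K.fromℕ 2 K.* R) [ 2R≉0 ]) * MV.lucasSum (- 1# * τ) m
      + (- 1#) ^ ((p ℕ.+ 1) ℕ./ 2)
        * ι (d K./ (K.fromℕ 2 K.* R K.* D) [ K.*-≉0 2R≉0 D≉0 ]) * u
  eval-APoly m p≡ u τ τD≈u² = begin
    ⟦ A ⟧
      ≈⟨ eval-+ (K[Z].const j K[Z].* K[Z].sum terms) _ ⟩
    ⟦ K[Z].const j K[Z].* K[Z].sum terms ⟧ + ⟦ K[Z].const (σ K.* k) K[Z].* K[Z].Z ⟧
      ≈⟨ +-cong (trans (eval-* (K[Z].const j) (K[Z].sum terms)) (*-cong (eval-const j) (eval-sum terms)))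
                (trans (eval-* (K[Z].const (σ K.* k)) K[Z].Z) (*-cong (eval-const _) eval-Z)) ⟩
    ι j * sum (λ i → ⟦ terms i ⟧) + ι (σ K.* k) * u
      ≈⟨ +-cong (*-congˡ sum≈) (*-congʳ (trans (*-homo σ k) (*-congʳ (ι-[-1]^ ((p ℕ.+ 1) ℕ./ 2))))) ⟩
    ι j * MV.lucasSum (- 1# * τ) m + (- 1#) ^ ((p ℕ.+ 1) ℕ./ 2) * ι k * u ∎
    where
    open Evaluation {K = K} {L = L} isRingHomomorphism u
    j = K.1# K./ (K.fromℕ 2 K.* R) [ 2R≉0 ]
    k = d K./ (K.fromℕ 2 K.* R K.* D) [ K.*-≉0 2R≉0 D≉0 ]
    σ = (K.- K.1#) K.^ ((p ℕ.+ 1) ℕ./ 2)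
    terms : Fin (suc ((p ℕ.∸ 1) ℕ./ 2)) → K[Z].Poly
    terms i = K[Z].const (a (toℕ i) K./ D K.^ toℕ i [ K.^-≉0 D≉0 (toℕ i) ])
                K[Z].* K[Z].Z K[Z].^ (2 ℕ.* toℕ i)
    sum≈ : sum (λ i → ⟦ terms i ⟧) ≈ MV.lucasSum (- 1# * τ) m
    sum≈ = begin
      sum (λ i → ⟦ terms i ⟧)
        ≈⟨ sum-cong-≋ {suc ((p ℕ.∸ 1) ℕ./ 2)} (λ i → trans
             (trans (eval-* (K[Z].const _) (K[Z].Z K[Z].^ (2 ℕ.* toℕ i)))
                    (*-cong (eval-const _) (eval-Z^ (2 ℕ.* toℕ i))))
             (APoly-term m p≡ u τ τD≈u² (toℕ i))) ⟩
      sum {suc ((p ℕ.∸ 1) ℕ./ 2)} (λ i → lucas m (toℕ i) · (- 1# * τ) ^ toℕ i)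
        -- Only the number of terms differs: (p-1)/2 + 1 against m + 2.
        ≡⟨ ≡.cong (λ N → sum {suc N} (λ i → lucas m (toℕ i) · (- 1# * τ) ^ toℕ i))
             ([p∸1]/2≡m (suc m) p≡) ⟩
      MV.lucasSum (- 1# * τ) m ∎

-- The two roots as an unordered pair.

-- The exponents are variables because (p-1)/2 and (p+1)/2 do not compute for a variable p; matching
-- on `refl` turns them into m+1 and m+2. Elements coming from K enter only through equations in L.
pair≐radicals : ∀ {c ℓ} (L : Field c ℓ) → let open Field L in
  ∀ m {M₁ M₂} → M₁ ≡ suc m → M₂ ≡ suc (suc m) →
  ∀ {y y′ d r R D i j k τ A} →
  let u = (y * y′) ^ M₁ * (y + y′)
      w = (y * y′) ^ M₂
  in
  y ^ suc (suc m ℕ.* 2) ≈ d + r → y′ ^ suc (suc m ℕ.* 2) + r ≈ d →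
  r * r ≈ R → D + R ≈ d * d →
  i * ((1# + 1#) * D) ≈ 1# → j * ((1# + 1#) * R) ≈ 1# → k * ((1# + 1#) * R * D) ≈ d →
  τ * D ≈ u * u →
  A ≈ j * MorganVoyce.lucasSum commutativeRing (- 1# * τ) m + (- 1#) ^ M₂ * k * u →
  pair y y′ ≐ pair (w * (u * i + A * r)) (w * (u * i - A * r))
pair≐radicals L m ≡.refl ≡.refl {r = r} {D = D} {i = i} hy hy′ r²≈R D+R≈d² hi hj hk hτ hA =
  pair≐half-sums 2≉0 ([-1]^n≈±1 (suc m))
    (2*w*u*i≈y+y′ hy hy′ D+r²≈d² hi hj′ hk′ hτ)
    (trans (*-congˡ (*-congˡ (*-congʳ hA)))
      (2*w*A*r≈±[y′-y] hy hy′ D+r²≈d² hi hj′ hk′ hτ))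
  where
  open Field L
  open FieldProperties L
  open Radicals commutativeRing m
  D+r²≈d² = trans (+-congˡ r²≈R) D+R≈d²
  hj′ = trans (*-congˡ (*-congˡ r²≈R)) hj
  hk′ = trans (*-congˡ (*-congʳ (*-congˡ r²≈R))) hk
  2≉0 : 1# + 1# ≉ 0#
  -- As 2D has the inverse i, 2 = 0 would give 1 = 0.
  2≉0 2≈0 = 1≉0 (trans (sym hi) (trans (*-congˡ (trans (*-congʳ 2≈0) (zeroˡ D))) (zeroʳ i)))

theorem1 :
  ∀ {c ℓ c′ ℓ′} (p : ℕ) (3≤p : 3 ℕ.≤ p) (p-odd : ¬ 2 ∣ p)
    (K : Field c ℓ) (char0 : CharacteristicZero K)
    (K̄ : AlgebraicClosure K c′ ℓ′) →
  let module K = Field K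
      L = AlgebraicClosure.closure K̄
      open Field L
      open AlgebraicClosure K̄ using (ι)
      open Polynomial L using (IsZeroOf)
  in
  (d R : K.Carrier) (d≉0 : d K.≉ K.0#) (R≉0 : R K.≉ K.0#)
  (√R : Carrier) (√R²≈R : √R * √R ≈ ι R)
  (√R∉K : ¬ (∃[ k ] ι k ≈ √R))
  (g-irreducible : Polynomial.Irreducible K (gPoly K p d R))
  (y y′ : Carrier)
  (hy≈0 : IsZeroOf y (hPoly L p (ι d) √R))
  (h′y′≈0 : IsZeroOf y′ (h′Poly L p (ι d) √R)) →
  let D   = disc K d R
      D≉0 = disc≉0 K̄ d R √R²≈R √R∉K
      2D≉0 = K.*-≉0 (fromℕ≉0 K char0 2) D≉0
      z   = y * y′
      u   = z ^ ((p ℕ.∸ 1) ℕ./ 2) * (y + y′)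
      A   = APoly K char0 p 3≤p d R R≉0 D≉0
      A[u] = AlgebraicClosure.evalAt K̄ A u
      u/2D = u * ι (K.1# K./ (K.fromℕ 2 K.* D) [ 2D≉0 ])
      w   = z ^ ((p ℕ.+ 1) ℕ./ 2)
  in
  pair y y′ ≐ pair (w * (u/2D + A[u] * √R)) (w * (u/2D - A[u] * √R))
theorem1 p 3≤p p-odd K char0 K̄ d R d≉0 R≉0 √R √R²≈R √R∉K g-irreducible y y′ hy≈0 h′y′≈0
  with m , p≡ ← odd⇒half p 3≤p p-odd =
  pair≐radicals L m ([p∸1]/2≡m (suc m) p≡) ([p+1]/2≡1+m (suc m) p≡)
    (trans (^-cong-p p≡ y) (hPoly-zero L p (ι d) √R y hy≈0))
    (trans (+-congʳ (^-cong-p p≡ y′)) (h′Poly-zero L p (ι d) √R y′ h′y′≈0))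
    √R²≈R ιD+ιR≈ιd²
    -- The quotients 1/(2D), 1/(2R) and d/(2RD) are formed in K; each is handed over as its image
    -- under `ι`, with the equation that clears its denominator.
    (trans (*-congˡ (sym (ι-2* D))) (trans (ι-/ K.1# (K.fromℕ 2 K.* D) _) 1#-homo))
    (trans (*-congˡ (sym (ι-2* R))) (trans (ι-/ K.1# (K.fromℕ 2 K.* R) _) 1#-homo))
    (trans (*-congˡ (sym (trans (*-homo _ D) (*-congʳ (ι-2* R))))) (ι-/ d (K.fromℕ 2 K.* R K.* D) _))
    τ*ιD≈u²
    (eval-APoly char0 K̄ p 3≤p d R R≉0 D≉0 m p≡ u τ τ*ιD≈u²)
  where
  module K = Field K
  L = AlgebraicClosure.closure K̄
  open Field L
  open AlgebraicClosure K̄ using (ι; isRingHomomorphism; ⟦⟧-cong; +-homo; *-homo; 1#-homo)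
  open HomProperties {K = K} {L = L} isRingHomomorphism
  open Relation.Binary.Reasoning.Setoid setoid

  D   = disc K d R
  D≉0 = disc≉0 K̄ d R √R²≈R √R∉K
  u   = (y * y′) ^ ((p ℕ.∸ 1) ℕ./ 2) * (y + y′)
  D⁻¹ = K.1# K./ D [ D≉0 ]
  τ   = u * u * ι D⁻¹

  τ*ιD≈u² : τ * ι D ≈ u * u
  τ*ιD≈u² = begin
    u * u * ι D⁻¹ * ι D    ≈⟨ *-assoc (u * u) _ _ ⟩
    u * u * (ι D⁻¹ * ι D)  ≈⟨ *-congˡ (trans (ι-/ K.1# D D≉0) 1#-homo) ⟩
    u * u * 1#             ≈⟨ *-identityʳ (u * u) ⟩
    u * u                  ∎

  ι-2* : ∀ x → ι (K.fromℕ 2 K.* x) ≈ (1# + 1#) * ι x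
  ι-2* x = trans (*-homo (K.fromℕ 2) x) (*-congʳ ι-2)

  ιD+ιR≈ιd² : ι D + ι R ≈ ι d * ι d
  ιD+ιR≈ιd² = begin
    ι D + ι R     ≈⟨ +-homo D R ⟨
    ι (D K.+ R)   ≈⟨ ⟦⟧-cong (K.trans (K.+-assoc _ _ R) (K.trans
                       (K.+-cong (K.*-congˡ (K.*-identityʳ d)) (K.-‿inverseˡ R)) (K.+-identityʳ _))) ⟩
    ι (d K.* d)   ≈⟨ *-homo d d ⟩
    ι d * ι d     ∎

  ^-cong-p : ∀ {n} → p ≡ n → ∀ x → x ^ n ≈ x ^ p
  ^-cong-p p≡n x = reflexive (≡.cong (x ^_) (≡.sym p≡n))
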